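{- Let $A$ be a nonempty finite set of positive integers and let $i \ge 0$, $j \ge 1$ be integers. There exists a bijection $\mathcal{L}_{i,j}(A) \to \mathcal{L}_{i+1,j-1}(A)$ that preserves the weight $\omega$, i.e. if $(T,\phi)$ is mapped to $(T',\phi')$ then $\omega(T,\phi) = \omega(T',\phi')$.
   Context: A labelled tree $T$ with vertex labels given by $A$ is a tree (acyclic connected graph) with vertex set $A$; it is rooted at the vertex $\min(A)$, and is unordered. For a non-root vertex $w$, its father $f_T(w)$ is the neighbour of $w$ on the unique path from $w$ to the root. A non-root vertex $w$ is increasing if $f_T(w) < w$ and decreasing otherwise; the root is neither increasing nor decreasing. The hook $h_T(w)$ is the set of vertices $u$ such that $w$ lies on the unique path from the root to $u$ (so $w \in h_T(w)$). For integers $i,j \ge 0$, $\mathcal{L}_{i,j}(A)$ is the set of pairs $(T,\phi)$ where $T$ is a labelled tree with vertex labels given by $A$ (rooted at $\min(A)$), $\phi$ is a function from the set of increasing vertices of $T$ to $A$, and: (1) for any increasing vertex $v$ of $T$, $\phi(v) \in h_T(v)$ and $\phi(v) \ge v$; (2) if $v$ is an increasing vertex of $T$ and $\phi(v) \ne v$, then every vertex on the unique path from $v$ to the root (not including the root) is increasing; (3) if $v$ is a decreasing vertex of $T$ and $u$ is an increasing vertex with $\phi(u) \neq u$, then $u < v$; (4) $T$ has exactly $i$ decreasing vertices; (5) $T$ has exactly $j$ increasing vertices $v$ with $\phi(v) \neq v$. Let $x_a$ ($a \in A$) and $y_{a,b}$ ($a,b \in A$, $a \le b$) be commuting indeterminates.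 The weight of $(T,\phi)$ is the monomial $$\omega(T,\phi) = \prod_{w \text{ increasing in } T} x_{f_T(w)}\, y_{w,\phi(w)} \prod_{w \text{ decreasing in } T} x_w\, y_{w,f_T(w)}.$$ -}

module Defs where

open import Data.Bool.Base using (Bool; T)
open import Data.Irrelevant using ([_])
open import Data.List.Base using (List; []; _∷_; length; filter; concatMap)
open import Data.List.Membership.Propositional using (_∈_; mapWith∈)
open import Data.List.NonEmpty.Base using (List⁺; head; toList)
open import Data.List.Relation.Unary.All using (All)
open import Data.List.Relation.Unary.AllPairs using (AllPairs)
open import Data.List.Relation.Unary.Any using (here)
open import Data.List.Relation.Unary.Unique.Propositional using (Unique)
open import Data.Nat.Base using (ℕ; _≤_; _<_)
open import Data.Nat.Properties
  using (_≟_; _<?_; <-cmp; <⇒≤; <-irrelevant)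
open import Data.Product.Base using (Σ-syntax; ∃; _,_; proj₁)
open import Data.Refinement as Refinement using (Refinement; value)
open import Function.Base using (_∘_)
open import Function.Bundles using (_⇔_; Equivalence)
open import Level using (0ℓ)
open import Relation.Binary.Bundles using (Setoid)
open import Relation.Binary.Core using (Rel)
open import Relation.Binary.Construct.Closure.ReflexiveTransitive
  using (Star; ε; _◅_)
open import Relation.Binary.Definitions
  using (Symmetric; tri<; tri≈; tri>)
open import Relation.Binary.PropositionalEquality
  using (_≡_; _≢_; refl; sym; trans; cong; subst)
open import Relation.Nullary.Decidable using (Dec; yes; no; ¬?; map′)
open import Relation.Nullary.Negation.Core using (¬_)
open import Relation.Unary using (Decidable)
import Function.Properties.Equivalence as ⇔

-- A nonempty finite set of positive integers, given by its unique strictly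
-- increasing enumeration, so that the head of the list is the minimum.
record LabelSet : Set where
  field
    labels    : List⁺ ℕ
    ascending : AllPairs _<_ (toList labels)
    positive  : All (0 <_) (toList labels)

module _ (A : LabelSet) where
  open LabelSet A

  -- Membership is irrelevant here, so vertices with the same label are equal.
  Vertex : Set
  Vertex = Refinement ℕ (_∈ toList labels)

  _≟ᵛ_ : (u v : Vertex) → Dec (u ≡ v)
  _≟ᵛ_ = Refinement._≟_ _≟_

  vertices : List Vertex
  vertices = mapWith∈ (toList labels) λ {a} a∈A → Refinement._,_ a [ a∈A ]

  root : Vertex
  root = Refinement._,_ (head labels) [ here refl ]

  record Graph : Set where
    field
      adjacent : Vertex → Vertex → Bool

    infix 4 _~_
    _~_ : Rel Vertex 0ℓ
    u ~ v = T (adjacent u v)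

    field
      symmetric   : Symmetric _~_
      irreflexive : ∀ {v} → ¬ (v ~ v)

    visited : ∀ {u v} → Star _~_ u v → List Vertex
    visited {u} ε       = u ∷ []
    visited {u} (_ ◅ w) = u ∷ visited w

    Path : Vertex → Vertex → Set
    Path u v = Σ[ w ∈ Star _~_ u v ] Unique (visited w)

    onPath : ∀ {u v} → Path u v → List Vertex
    onPath = visited ∘ proj₁

    second : ∀ {u v} → Path u v → Vertex
    second {u} (ε , _)               = u
    second     (_◅_ {j = w} _ _ , _) = w

    Connected : Set
    Connected = ∀ u v → Path u v

    -- A cycle is a path on at least three vertices together with an edge
    -- joining its two ends.
    Acyclic : Set
    Acyclic = ∀ {u v} (p : Path u v) → 3 ≤ length (onPath p) → ¬ (v ~ u)

  record Tree : Set where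
    field
      graph : Graph

    open Graph graph public

    -- By acyclicity the path selected by `connected` is the unique one, so
    -- nothing below depends on the choice of this field.
    field
      connected : Connected
      acyclic   : Acyclic

    -- The path from the root to itself has no second vertex, and `second`
    -- returns the root there; hence `father root` is `root`, and the root is
    -- neither increasing nor decreasing.
    father : Vertex → Vertex
    father w = second (connected w root)

    Increasing : Vertex → Set
    Increasing w = value (father w) < value w

    Decreasing : Vertex → Set
    Decreasing w = value w < value (father w)

    increasing? : Decidable Increasing
    increasing? w = value (father w) <? value w

    decreasing? : Decidable Decreasing
    decreasing? w = value w <? value (father w)

    Hook : Vertex → Vertex → Set
    Hook w u = w ∈ onPath (connected root u)

  module Marking (tree : Tree) (φ : ∃ (Tree.Increasing tree) → Vertex) where
    open Tree tree

    Moved : Vertex → Set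
    Moved v = Σ[ inc ∈ Increasing v ] φ (v , inc) ≢ v

    moved? : Decidable Moved
    moved? v with increasing? v
    ... | no ¬inc = no (¬inc ∘ proj₁)
    ... | yes inc = map′ (inc ,_) drop (¬? (φ (v , inc) ≟ᵛ v))
      where
      drop : Moved v → φ (v , inc) ≢ v
      drop (inc′ , ≢v) = subst (λ i → φ (v , i) ≢ v) (<-irrelevant inc′ inc) ≢v

  record 𝓛 (i j : ℕ) : Set where
    field
      tree : Tree
      φ    : ∃ (Tree.Increasing tree) → Vertex

    open Tree tree public
    open Marking tree φ public

    field
      φ-hook : ∀ v (inc : Increasing v) → Hook v (φ (v , inc))
      φ-≥    : ∀ v (inc : Increasing v) → value v ≤ value (φ (v , inc))
      moved-path : ∀ v → Moved v →
        ∀ u → u ∈ onPath (connected v root) → u ≢ root → Increasing u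
      moved<decreasing : ∀ v u → Decreasing v → Moved u → value u < value v
      #decreasing : length (filter decreasing? vertices) ≡ i
      #moved      : length (filter moved? vertices) ≡ j

  -- Equality of pairs (T , φ): the same edges, and φ has the same domain and
  -- the same values.  Proof components are disregarded.
  record _≈_ {i j k l : ℕ} (P : 𝓛 i j) (Q : 𝓛 k l) : Set where
    private
      module P = 𝓛 P
      module Q = 𝓛 Q
    field
      edges  : ∀ u v → P.adjacent u v ≡ Q.adjacent u v
      domain : ∀ v → P.Increasing v ⇔ Q.Increasing v
      values : ∀ v (p : P.Increasing v) (q : Q.Increasing v) →
               P.φ (v , p) ≡ Q.φ (v , q)

  𝓛-setoid : ℕ → ℕ → Setoid 0ℓ 0ℓ
  𝓛-setoid i j = record
    { Carrier       = 𝓛 i j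
    ; _≈_           = _≈_
    ; isEquivalence = record
      { refl  = λ {P} → record
        { edges  = λ _ _ → refl
        ; domain = λ _ → ⇔.refl
        ; values = λ v p q → cong (λ inc → 𝓛.φ P (v , inc)) (<-irrelevant p q)
        }
      ; sym   = λ e → record
        { edges  = λ u v → sym (edges e u v)
        ; domain = λ v → ⇔.sym (domain e v)
        ; values = λ v p q → sym (values e v q p)
        }
      ; trans = λ e f → record
        { edges  = λ u v → trans (edges e u v) (edges f u v)
        ; domain = λ v → ⇔.trans (domain e v) (domain f v)
        ; values = λ v p r → let q = Equivalence.to (domain e v) p in
                   trans (values e v p q) (values f v q r)
        }
      }
    }
    where open _≈_

  data Indeterminate : Set where
    x⟨_⟩     : Vertex → Indeterminate
    y⟨_,_⟩[_] : (a b : Vertex) → .(value a ≤ value b) → Indeterminate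

  -- A monomial is a list of indeterminates, to be compared up to permutation.
  Monomial : Set
  Monomial = List Indeterminate

  module _ {i j : ℕ} (P : 𝓛 i j) where
    open 𝓛 P

    -- The middle case occurs only for the root, which contributes no factor.
    factor : Vertex → Monomial
    factor w with <-cmp (value (father w)) (value w)
    ... | tri< inc _ _ = x⟨ father w ⟩ ∷ y⟨ w , φ (w , inc) ⟩[ φ-≥ w inc ] ∷ []
    ... | tri≈ _ _ _   = []
    ... | tri> _ _ dec = x⟨ w ⟩ ∷ y⟨ w , father w ⟩[ <⇒≤ dec ] ∷ []

    ω : Monomial
    ω = concatMap factor vertices

-- A tree rooted at the minimum is its father function f.  Given (T , φ) with j ≥ 1,
-- let v be the largest increasing vertex with u = φ v ≢ v, let p be its father,
-- and let c be the child of v towards u.  Hang c under p and v under u.  By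
-- condition (3) c is increasing both before and after, and v becomes the smallest
-- decreasing vertex; only the factors of v and c change,
--   x_p y_{v,u} · x_v y_{c,φ c}  becoming  x_v y_{v,u} · x_p y_{c,φ c}.
-- Conversely, v is recovered as the smallest decreasing vertex, u as its father,
-- and c as the first vertex greater than v on the path from the root to u: the
-- vertices before it are less than v, hence none of them is decreasing.
module Submission where

open import Defs
open import Data.Nat.Base using (ℕ; suc; _∸_; _≥_)
open import Data.Product.Base using (Σ-syntax)
open import Data.List.Relation.Binary.Permutation.Propositional using (_↭_)
open import Function.Bundles using (Bijection)

open import Data.Bool.Base using (T)
open import Data.Bool.Properties using (T-≡; ⇔→≡)
open import Data.Irrelevant using ([_])
open import Data.List.Base using (List; []; _∷_; _++_; length; map; filter; concat; concatMap)
import Data.List.Extrema as Extrema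
import Data.List.Membership.DecPropositional as DecMembership
open import Data.List.Membership.Propositional using (_∈_; _∉_)
open import Data.List.Membership.Propositional.Properties
  using (∈-∃++; ∈-map⁻; ∈-filter⁺; ∈-filter⁻; map-mapWith∈; mapWith∈-id)
open import Data.List.NonEmpty.Base using (List⁺; head; toList) renaming (_∷_ to _∷⁺_)
open import Data.List.Properties
  using (∷-injectiveˡ; ∷-injectiveʳ; concatMap-cong; map-cong-local;
         filter-accept; filter-reject; filter-≐)
open import Data.List.Relation.Binary.Permutation.Propositional
  using (prep; swap; ↭-refl; ↭-sym; ↭-trans; ↭-prep; ↭-swap; ↭⇒↭ₛ;
         module PermutationReasoning)
open import Data.List.Relation.Binary.Permutation.Propositional.Properties
  using (shift; ++⁺ˡ; ++⁺ʳ; ++-comm; ++-assoc; filter-↭; ↭-length; ∈-resp-↭)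
import Data.List.Relation.Binary.Permutation.Propositional as Perm
import Data.List.Relation.Binary.Permutation.Setoid.Properties as ↭ₛ
open import Data.List.Relation.Binary.Subset.Propositional using (_⊆_)
open import Data.List.Relation.Unary.All as All using (All; []; _∷_)
open import Data.List.Relation.Unary.All.Properties using (¬Any⇒All¬; All¬⇒¬Any)
open import Data.List.Relation.Unary.AllPairs as AllPairs using (AllPairs; []; _∷_)
open import Data.List.Relation.Unary.Any using (here; there)
open import Data.List.Relation.Unary.Unique.Propositional using (Unique)
import Data.List.Relation.Unary.Unique.Propositional.Properties as Unique
open import Data.Nat.Base using (_≤_; _<_; z≤n; s≤s)
open import Data.Nat.Properties as ℕ using (_≤?_; _<?_; <-cmp)
open import Data.Product.Base using (∃; _×_; _,_; proj₁; proj₂)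
open import Data.Refinement as Refinement using (value; value-injective)
open import Data.Sum.Base as Sum using (_⊎_; inj₁; inj₂; [_,_]′)
open import Function.Base using (_∘_; id; _$_)
open import Function.Bundles using (Equivalence; mk⇔)
import Function.Properties.Equivalence as ⇔
open import Level using (0ℓ)
open import Relation.Binary.Construct.Closure.ReflexiveTransitive
  using (Star; ε; _◅_; _◅◅_)
open import Relation.Binary.Definitions using (DecidableEquality; tri<; tri≈; tri>)
open import Relation.Binary.PropositionalEquality
  using (_≡_; _≢_; _≗_; refl; sym; trans; cong; cong₂; subst; setoid; module ≡-Reasoning)
open import Relation.Nullary.Decidable
  using (Dec; yes; no; ¬?; _×-dec_; _⊎-dec_; isYes; toWitness; fromWitness; recompute)
open import Relation.Nullary.Negation using (¬_; contradiction)
open import Relation.Unary using (Pred; Decidable)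

-- The extremal choices protect the rest of the pair. By `moved-path`, labels decrease from a moved
-- vertex towards the root, so the moved vertices smaller than the largest one, `v`, have neither
-- `v` nor `c` above them, and the move leaves their paths alone. In the other direction, taking the
-- smallest decreasing vertex keeps `moved<decreasing` true once `v` is moved again. A pair carries
-- data that its equality disregards, such as the paths chosen by `connected`, and the domain of `φ`
-- varies with the tree. `Code` therefore retains only a father function and a total mark, and the
-- move is a relation `Step` given by pointwise equations. Existence and uniqueness of `Step` on
-- either side yield the bijection, with no need to compose two maps.

-- Ancestry under a father function

-- For a father function f, Climb f u w says that u lies in the hook of w.
data Climb {V : Set} (f : V → V) : V → V → Set where
  stop : ∀ {u} → Climb f u u
  up   : ∀ {u w} → Climb f (f u) w → Climb f u w

module _ {V : Set} {f : V → V} where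

  climb-trans : ∀ {u v w} → Climb f u v → Climb f v w → Climb f u w
  climb-trans stop   d = d
  climb-trans (up c) d = up (climb-trans c d)

  step : ∀ {u v} → f u ≡ v → Climb f u v
  step refl = up stop

  climb-step : ∀ {u v w} → f u ≡ v → Climb f v w → Climb f u w
  climb-step refl = up

  comparable : ∀ {u v w} → Climb f u v → Climb f u w → Climb f v w ⊎ Climb f w v
  comparable stop   d      = inj₁ d
  comparable (up c) stop   = inj₂ (up c)
  comparable (up c) (up d) = comparable c d

  -- Only the values of `f` at ancestors of `u` matter, so redirecting fathers elsewhere leaves this
  -- climb intact.
  climb-agree : ∀ {g : V → V} {u w} → (∀ {x} → Climb f u x → f x ≡ g x) →
                Climb f u w → Climb g u w
  climb-agree f≗g stop   = stop
  climb-agree {g} {u} {w} f≗g (up c) =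
    up (subst (λ x → Climb g x w) (f≗g stop) (climb-agree (f≗g ∘ up) c))

  climb-agree⁻ : ∀ {g : V → V} {u w} → (∀ {x} → Climb f u x → f x ≡ g x) →
                 Climb g u w → Climb f u w
  climb-agree⁻ {g} f≗g = go f≗g refl
    where
    -- The two starting points are only propositionally equal: after one step they are `g u` and
    -- `f u`.
    go : ∀ {u v w} → (∀ {x} → Climb f u x → f x ≡ g x) → v ≡ u →
         Climb g v w → Climb f u w
    go f≗g refl stop   = stop
    go f≗g refl (up c) = up (go (f≗g ∘ up) (sym (f≗g stop)) c)

Link : {V : Set} → (V → V) → V → V → Set
Link f u v = u ≢ v × (f u ≡ v ⊎ f v ≡ u)

module Rooted {V : Set} (_≟_ : DecidableEquality V) (root : V)
  (f : V → V) (f-root : f root ≡ root) (reach : ∀ v → Climb f v root) where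

  climb-root : ∀ {v} → Climb f root v → v ≡ root
  climb-root c = go refl c
    where
    go : ∀ {u v} → u ≡ root → Climb f u v → v ≡ root
    go u≡r stop   = u≡r
    go u≡r (up c) = go (trans (cong f u≡r) f-root) c

  fixed⇒root : ∀ {v} → f v ≡ v → v ≡ root
  fixed⇒root {v} = go (reach v)
    where
    go : ∀ {v} → Climb f v root → f v ≡ v → v ≡ root
    go stop   _  = refl
    go (up c) eq = trans (sym eq) (go c (cong f eq))

  -- Reaching the root excludes cycles of `f`: by induction along the climb from `u` to the root,
  -- `f u` equals both `u` and `v`.
  climb-antisym : ∀ {u v} → Climb f u v → Climb f v u → u ≡ v
  climb-antisym {u} = go (reach u)
    where
    go : ∀ {u v} → Climb f u root → Climb f u v → Climb f v u → u ≡ v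
    go r      stop   _ = refl
    go stop   c      _ = sym (climb-root c)
    go (up r) (up c) d = trans (sym fu≡u) (go r c (climb-trans d (up stop)))
      where fu≡u = go r (climb-trans c d) (up stop)

  climb? : ∀ u w → Dec (Climb f u w)
  climb? u w = go (reach u)
    where
    go : ∀ {u} → Climb f u root → Dec (Climb f u w)
    go stop with root ≟ w
    ... | yes refl = yes stop
    ... | no r≢w   = no (r≢w ∘ sym ∘ climb-root)
    go {u} (up r) with u ≟ w
    ... | yes refl = yes stop
    ... | no u≢w with go r
    ...   | yes c = yes (up c)
    ...   | no ¬c = no λ where
      stop   → u≢w refl
      (up c) → ¬c c

  -- The unoriented edges and the root determine all fathers. If `g` reversed the edge from `v` to
  -- `f v`, the induction hypothesis at `f v` would give `f (f v) ≡ v`, a cycle.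
  link-unique : ∀ {g : V → V} → g root ≡ root →
                (∀ {u v} → Link f u v → Link g u v) → f ≗ g
  link-unique {g} g-root links v = go (reach v)
    where
    go : ∀ {v} → Climb f v root → f v ≡ g v
    go stop = trans f-root (sym g-root)
    go {v} (up c) with v ≟ f v
    ... | yes eq = subst (λ x → f x ≡ g x)
                     (sym (fixed⇒root (sym eq))) (trans f-root (sym g-root))
    ... | no v≢fv with proj₂ (links (v≢fv , inj₁ refl))
    ...   | inj₁ gv≡fv  = sym gv≡fv
    ...   | inj₂ gfv≡v = contradiction
              (climb-antisym (up stop) (step (trans (go c) gfv≡v))) v≢fv

-- Counting, exchange and extremal entries in lists

module _ {X : Set} where

  extract : ∀ {v : X} {xs} → Unique xs → v ∈ xs →
            ∃ λ ys → xs ↭ v ∷ ys × Unique (v ∷ ys)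
  extract {v} uniq v∈xs with ∈-∃++ v∈xs
  ... | ys , zs , refl = ys ++ zs , shift v ys zs ,
    ↭ₛ.Unique-resp-↭ (setoid X) (↭⇒↭ₛ (shift v ys zs)) uniq

  concatMap-↭ : ∀ {Y : Set} (h : X → List Y) {xs ys} → xs ↭ ys →
                concatMap h xs ↭ concatMap h ys
  concatMap-↭ h Perm.refl          = ↭-refl
  concatMap-↭ h (prep x p)         = ++⁺ˡ (h x) (concatMap-↭ h p)
  concatMap-↭ h (Perm.trans p q)   = ↭-trans (concatMap-↭ h p) (concatMap-↭ h q)
  concatMap-↭ h (swap {xs} {ys} x y p) = begin
    h x ++ h y ++ concatMap h xs   ↭⟨ ++-assoc (h x) (h y) _ ⟨
    (h x ++ h y) ++ concatMap h xs ↭⟨ ++⁺ʳ _ (++-comm (h x) (h y)) ⟩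
    (h y ++ h x) ++ concatMap h xs ↭⟨ ++-assoc (h y) (h x) _ ⟩
    h y ++ h x ++ concatMap h xs   ↭⟨ ++⁺ˡ (h y) (++⁺ˡ (h x) (concatMap-↭ h p)) ⟩
    h y ++ h x ++ concatMap h ys   ∎
    where open PermutationReasoning

  module _ {P Q : Pred X 0ℓ} (P? : Decidable P) (Q? : Decidable Q) where

    filter-cong-local : ∀ {xs} → All (λ x → (P x → Q x) × (Q x → P x)) xs →
                        filter P? xs ≡ filter Q? xs
    filter-cong-local [] = refl
    filter-cong-local {x ∷ xs} ((p⇒q , q⇒p) ∷ eqs) with P? x
    ... | yes p = trans (cong (x ∷_) (filter-cong-local eqs))
                        (sym (filter-accept Q? (p⇒q p)))
    ... | no ¬p = trans (filter-cong-local eqs)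
                        (sym (filter-reject Q? (¬p ∘ q⇒p)))

    -- Serves both counts: the decreasing vertices gain `v`, the moved ones lose it.
    length-filter-insert : ∀ {v xs} → Unique xs → v ∈ xs → ¬ P v → Q v →
      (∀ {x} → x ≢ v → (P x → Q x) × (Q x → P x)) →
      length (filter Q? xs) ≡ suc (length (filter P? xs))
    length-filter-insert {v} {xs} uniq v∈xs ¬pv qv iff with extract uniq v∈xs
    ... | ys , xs↭ , v∉ys ∷ _ = begin
      length (filter Q? xs)        ≡⟨ ↭-length (filter-↭ Q? xs↭) ⟩
      length (filter Q? (v ∷ ys))  ≡⟨ cong length (filter-accept Q? qv) ⟩
      suc (length (filter Q? ys))  ≡⟨ cong (suc ∘ length) (filter-cong-local
                                        (All.map (λ v≢x → iff (v≢x ∘ sym)) v∉ys)) ⟨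
      suc (length (filter P? ys))  ≡⟨ cong (suc ∘ length) (filter-reject P? ¬pv) ⟨
      suc (length (filter P? (v ∷ ys))) ≡⟨ cong suc (↭-length (filter-↭ P? xs↭)) ⟨
      suc (length (filter P? xs))  ∎
      where open ≡-Reasoning

  concatMap-cong-local : ∀ {Y : Set} {h k : X → List Y} {xs} →
    All (λ x → h x ≡ k x) xs → concatMap h xs ≡ concatMap k xs
  concatMap-cong-local eqs = cong concat (map-cong-local eqs)

  -- The move trades indeterminates between two vertices, so their factors are required to agree
  -- only jointly.
  concatMap-exchange : ∀ {Y : Set} (h k : X → List Y) {v w xs} →
    Unique xs → v ∈ xs → w ∈ xs → w ≢ v → h v ++ h w ↭ k v ++ k w →
    (∀ {x} → x ≢ v → x ≢ w → h x ≡ k x) →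
    concatMap h xs ↭ concatMap k xs
  concatMap-exchange h k {v} {w} {xs} uniq v∈ w∈ w≢v exch agree
    with extract uniq v∈
  ... | ys , xs↭ , v∉ys ∷ uniq′ with ∈-resp-↭ xs↭ w∈
  ...   | here w≡v = contradiction w≡v w≢v
  ...   | there w∈ys with extract uniq′ w∈ys
  ...     | zs , ys↭ , w∉zs ∷ _ = begin
    concatMap h xs                ↭⟨ concatMap-↭ h xs↭vwzs ⟩
    h v ++ h w ++ concatMap h zs  ↭⟨ ++-assoc (h v) (h w) _ ⟨
    (h v ++ h w) ++ concatMap h zs
      ≡⟨ cong ((h v ++ h w) ++_) (concatMap-cong-local {h = h} {k} {zs}
           (All.tabulate λ x∈ → agree
                 (λ { refl → All.lookup v∉ys (∈-resp-↭ (↭-sym ys↭) (there x∈)) refl })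
                 (λ { refl → All.lookup w∉zs x∈ refl }))) ⟩
    (h v ++ h w) ++ concatMap k zs ↭⟨ ++⁺ʳ _ exch ⟩
    (k v ++ k w) ++ concatMap k zs ↭⟨ ++-assoc (k v) (k w) _ ⟩
    k v ++ k w ++ concatMap k zs   ↭⟨ concatMap-↭ k xs↭vwzs ⟨
    concatMap k xs                ∎
    where
    open PermutationReasoning
    xs↭vwzs : xs ↭ v ∷ w ∷ zs
    xs↭vwzs = ↭-trans xs↭ (↭-prep v ys↭)

  module _ (h : X → ℕ) {P : Pred X 0ℓ} (P? : Decidable P) (xs : List X)
    (complete : ∀ x → x ∈ xs) {n : ℕ} (nonempty : length (filter P? xs) ≡ suc n) where

    open Extrema ℕ.≤-totalOrder

    private
      found : ∀ {x} → P x → x ∈ filter P? xs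
      found {x} = ∈-filter⁺ P? (complete x)

      satisfied : All P (filter P? xs)
      satisfied = All.tabulate (proj₂ ∘ ∈-filter⁻ P? {xs = xs})

    maximal : Σ[ m ∈ X ] P m × (∀ {x} → P x → h x ≤ h m)
    maximal = go (filter P? xs) nonempty found satisfied
      where
      -- With the filtered list abstracted, the length equation rules out `[]`, and the first entry
      -- serves as the default of `argmax`.
      go : ∀ ys → length ys ≡ suc n → (∀ {x} → P x → x ∈ ys) → All P ys →
           Σ[ m ∈ X ] P m × (∀ {x} → P x → h x ≤ h m)
      go (y ∷ ys) _ found (py ∷ pys) =
        argmax h y ys , argmax-all h py pys , λ px →
          All.lookup (f[⊥]≤f[argmax] {f = h} y ys ∷ f[xs]≤f[argmax] {f = h} y ys) (found px)

    minimal : Σ[ m ∈ X ] P m × (∀ {x} → P x → h m ≤ h x)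
    minimal = go (filter P? xs) nonempty found satisfied
      where
      go : ∀ ys → length ys ≡ suc n → (∀ {x} → P x → x ∈ ys) → All P ys →
           Σ[ m ∈ X ] P m × (∀ {x} → P x → h m ≤ h x)
      go (y ∷ ys) _ found (py ∷ pys) =
        argmin h y ys , argmin-all h py pys , λ px →
          All.lookup (f[argmin]≤f[⊤] {f = h} y ys ∷ f[argmin]≤f[xs] {f = h} y ys) (found px)

-- Redirecting fathers

module _ {V : Set} (_≟_ : DecidableEquality V) where

  update : (V → V) → V → V → V → V
  update f v a x with x ≟ v
  ... | yes _ = a
  ... | no _  = f x

  update-at : ∀ f v a → update f v a v ≡ a
  update-at f v a with v ≟ v
  ... | yes _   = refl
  ... | no v≢v = contradiction refl v≢v

  update-off : ∀ f v a {x} → x ≢ v → update f v a x ≡ f x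
  update-off f v a {x} x≢v with x ≟ v
  ... | yes x≡v = contradiction x≡v x≢v
  ... | no _    = refl

-- Applied to the climb from `g v` to `v`, this supplies the vertex `c` of the move.
below : {V : Set} → DecidableEquality V → {f : V → V} → ∀ {u w} →
        Climb f u w → u ≢ w → Σ[ c ∈ V ] Climb f u c × f c ≡ w
below _≟_ stop u≢w = contradiction refl u≢w
below _≟_ {f} {u} {w} (up k) _ with f u ≟ w
... | yes fu≡w = u , stop , fu≡w
... | no fu≢w  = let c , u↑c , fc≡w = below _≟_ k fu≢w in c , up u↑c , fc≡w

-- f′ moves v from f v to a place below its child c, and c up to f v.
module Cut {V : Set} (_≟_ : DecidableEquality V) (root : V)
  (f f′ : V → V) (f-root : f root ≡ root) (reach : ∀ v → Climb f v root)
  (v c : V) (v≢root : v ≢ root) (child : f c ≡ v)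
  (f′c : f′ c ≡ f v) (f′v : Climb f (f′ v) c)
  (agree : ∀ {x} → x ≢ v → x ≢ c → f′ x ≡ f x) where

  open Rooted _≟_ root f f-root reach

  c≢root : c ≢ root
  c≢root refl = v≢root (trans (sym child) f-root)

  v↛c : ¬ Climb f v c
  v↛c k = v≢root $ fixed⇒root $ trans (cong f (climb-antisym k (step child))) child

  -- The fathers change only at `v` and `c`, and both climb to `v`.
  outside : ∀ {z} → ¬ Climb f z v → ∀ {x} → Climb f z x → f x ≡ f′ x
  outside z↛v {x} z↑x with x ≟ v | x ≟ c
  ... | yes refl | _        = contradiction z↑x z↛v
  ... | no _     | yes refl = contradiction (climb-trans z↑x (step child)) z↛v
  ... | no x≢v   | no x≢c   = sym (agree x≢v x≢c)

  fv↛v : ¬ Climb f (f v) v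
  fv↛v k = v≢root (fixed⇒root (climb-antisym k (up stop)))

  climb-c : ∀ {z} → Climb f z c → Climb f′ z c
  climb-c stop = stop
  climb-c {z} (up k) with z ≟ v | z ≟ c
  ... | yes refl | _        = contradiction (up k) v↛c
  ... | no _     | yes refl = stop
  ... | no z≢v   | no z≢c   = climb-step (agree z≢v z≢c) (climb-c k)

  climb-fv : ∀ {w} → Climb f (f v) w → Climb f′ (f v) w
  climb-fv = climb-agree (outside fv↛v)

  c↑fv : Climb f′ c (f v)
  c↑fv = step f′c

  -- The old father of `v` remains its ancestor, by the detour through `c`.
  v↑fv : Climb f′ v (f v)
  v↑fv = up (climb-trans (climb-c f′v) c↑fv)

  f′-root : f′ root ≡ root
  f′-root = trans (agree (v≢root ∘ sym) (c≢root ∘ sym)) f-root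

  reach′ : ∀ z → Climb f′ z root
  reach′ z = go (reach z)
    where
    go : ∀ {z} → Climb f z root → Climb f′ z root
    go stop = stop
    go {z} (up k) with z ≟ v | z ≟ c
    ... | yes refl | _        = climb-trans v↑fv (climb-fv (reach (f v)))
    ... | no _     | yes refl = climb-trans c↑fv (climb-fv (reach (f v)))
    ... | no z≢v   | no z≢c   = climb-step (agree z≢v z≢c) (go k)

  -- The new paths from `v` and from `c` both rejoin the old one at `f v`, so the only ancestor that
  -- can be lost is `v` itself.
  climb′ : ∀ {z w} → w ≢ v → Climb f z w → Climb f′ z w
  climb′ w≢v stop = stop
  climb′ {z} w≢v (up k) with z ≟ v | z ≟ c
  ... | yes refl | _      = climb-trans v↑fv (climb-fv k)
  ... | no z≢v   | no z≢c = climb-step (agree z≢v z≢c) (climb′ w≢v k)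
  ... | no _     | yes refl with subst (λ x → Climb f x _) child k
  ...   | stop = contradiction refl w≢v
  ...   | up l = climb-trans c↑fv (climb-fv l)

  climb⁻ : ∀ {w x} → ¬ Climb f w v → Climb f′ w x → Climb f w x
  climb⁻ w↛v = climb-agree⁻ (outside w↛v)

-- The inverse of Cut: v, which hangs below c, is inserted between c and f c.
module Paste {V : Set} (_≟_ : DecidableEquality V) (root : V)
  (f f′ : V → V) (f-root : f root ≡ root) (reach : ∀ v → Climb f v root)
  (v c : V) (v≢root : v ≢ root) (v≢c : v ≢ c) (c≢root : c ≢ root)
  (f′v : f′ v ≡ f c) (f′c : f′ c ≡ v) (fv↑c : Climb f (f v) c)
  (agree : ∀ {x} → x ≢ v → x ≢ c → f′ x ≡ f x) where

  open Rooted _≟_ root f f-root reach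

  outside : ∀ {z} → ¬ Climb f z c → ∀ {x} → Climb f z x → f x ≡ f′ x
  outside z↛c {x} z↑x with x ≟ v | x ≟ c
  ... | yes refl | _        = contradiction (climb-trans z↑x (up fv↑c)) z↛c
  ... | no _     | yes refl = contradiction z↑x z↛c
  ... | no x≢v   | no x≢c   = sym (agree x≢v x≢c)

  fc↛c : ¬ Climb f (f c) c
  fc↛c k = c≢root (fixed⇒root (climb-antisym k (up stop)))

  climb-fc : ∀ {w} → Climb f (f c) w → Climb f′ (f c) w
  climb-fc = climb-agree (outside fc↛c)

  v↑fc : Climb f′ v (f c)
  v↑fc = step f′v

  c↑fc : Climb f′ c (f c)
  c↑fc = climb-step f′c v↑fc

  climb-c : ∀ {z} → ¬ Climb f z v → Climb f z c → Climb f′ z c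
  climb-c z↛v stop = stop
  climb-c {z} z↛v (up k) with z ≟ v | z ≟ c
  ... | yes refl | _        = contradiction stop z↛v
  ... | no _     | yes refl = stop
  ... | no z≢v   | no z≢c   = climb-step (agree z≢v z≢c) (climb-c (z↛v ∘ up) k)

  -- Makes the old father of `v` a legitimate mark of `v`: the path from `f v` to `c` is unchanged,
  -- and `c` now hangs under `v`.
  fv↑v : Climb f′ (f v) v
  fv↑v = climb-trans (climb-c fv↛v fv↑c) (step f′c)
    where
    fv↛v : ¬ Climb f (f v) v
    fv↛v k = v≢root (fixed⇒root (climb-antisym k (up stop)))

  f′-root : f′ root ≡ root
  f′-root = trans (agree (v≢root ∘ sym) (c≢root ∘ sym)) f-root

  reach′ : ∀ z → Climb f′ z root
  reach′ z = go (reach z)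
    where
    go : ∀ {z} → Climb f z root → Climb f′ z root
    go stop = stop
    go {z} (up k) with z ≟ v | z ≟ c
    ... | yes refl | _        = climb-trans v↑fc (climb-fc (reach (f c)))
    ... | no _     | yes refl = climb-trans c↑fc (climb-fc (reach (f c)))
    ... | no z≢v   | no z≢c   = climb-step (agree z≢v z≢c) (go k)

  -- Pasting costs `v` its ancestors from `f v` up to `c`. They all climb to `c`, so the assumption
  -- on `w` excludes them and leaves only proper ancestors of `c`.
  climb′ : ∀ {z w} → ¬ Climb f w c → Climb f z w → Climb f′ z w
  climb′ w↛c stop = stop
  climb′ {z} w↛c (up k) with z ≟ v | z ≟ c
  ... | no _   | yes refl = climb-trans c↑fc (climb-fc k)
  ... | no z≢v | no z≢c   = climb-step (agree z≢v z≢c) (climb′ w↛c k)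
  ... | yes refl | _ with comparable k fv↑c
  ...   | inj₁ w↑c    = contradiction w↑c w↛c
  ...   | inj₂ stop   = contradiction stop w↛c
  ...   | inj₂ (up l) = climb-trans v↑fc (climb-fc l)

  climb⁻ : ∀ {w x} → ¬ Climb f w c → Climb f′ w x → Climb f w x
  climb⁻ w↛c = climb-agree⁻ (outside w↛c)

-- Trees and father functions

module Walks {A : LabelSet} (G : Graph A) where
  open Graph G
  open DecMembership (_≟ᵛ_ A) using (_∈?_)

  private variable
    u v w x : Vertex A

  start∈ : (s : Star _~_ u v) → u ∈ visited s
  start∈ ε       = here refl
  start∈ (_ ◅ _) = here refl

  end∈ : (s : Star _~_ u v) → v ∈ visited s
  end∈ ε       = here refl
  end∈ (_ ◅ s) = there (end∈ s)

  extend : u ~ v → (p : Path v w) → u ∉ onPath p → Path u w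
  extend e (s , uniq) u∉s = e ◅ s , ¬Any⇒All¬ _ u∉s ∷ uniq

  suffix : ((s , _) : Path x v) → u ∈ visited s →
           Σ[ q ∈ Path u v ] onPath q ⊆ visited s
  suffix (ε , uniq)         (here refl) = (ε , uniq) , id
  suffix (e ◅ s , uniq)     (here refl) = (e ◅ s , uniq) , id
  suffix (e ◅ s , _ ∷ uniq) (there u∈s) with suffix (s , uniq) u∈s
  ... | q , q⊆s = q , there ∘ q⊆s

  -- Loop erasure: if the new start already lies on the erased path, only the suffix from there is
  -- kept. The inclusion lets a vertex missed by the walk be missed by the path.
  erase : (s : Star _~_ u v) → Σ[ p ∈ Path u v ] onPath p ⊆ visited s
  erase ε = (ε , [] ∷ []) , id
  erase {u} (e ◅ s) with erase s
  ... | p , p⊆s with u ∈? onPath p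
  ...   | no u∉p  = extend e p u∉p , λ where
    (here refl) → here refl
    (there x∈p) → there (p⊆s x∈p)
  ...   | yes u∈p with suffix p u∈p
  ...     | q , q⊆p = q , there ∘ p⊆s ∘ q⊆p

  turn : Star _~_ u v → Star _~_ u w → Star _~_ v w
  turn ε       t = t
  turn (e ◅ s) t = turn s (symmetric e ◅ t)

  turn-visited : (s : Star _~_ u v) (t : Star _~_ u w) →
                 x ∈ visited (turn s t) → x ∈ visited s ⊎ x ∈ visited t
  turn-visited ε       t x∈ = inj₂ x∈
  turn-visited (e ◅ s) t x∈ with turn-visited s (symmetric e ◅ t) x∈
  ... | inj₁ x∈s         = inj₁ (there x∈s)
  ... | inj₂ (here refl) = inj₁ (there (start∈ s))
  ... | inj₂ (there x∈t) = inj₂ x∈t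

  reversed : Star _~_ u v → Star _~_ v u
  reversed s = turn s ε

  reversed-visited : (s : Star _~_ u v) → visited (reversed s) ⊆ visited s
  reversed-visited s x∈ with turn-visited s ε x∈
  ... | inj₁ x∈s         = x∈s
  ... | inj₂ (here refl) = start∈ s

  ◅◅-visited : (s : Star _~_ u v) (t : Star _~_ v w) →
               x ∈ visited (s ◅◅ t) → x ∈ visited s ⊎ x ∈ visited t
  ◅◅-visited ε       t x∈          = inj₂ x∈
  ◅◅-visited (e ◅ s) t (here refl) = inj₁ (here refl)
  ◅◅-visited (e ◅ s) t (there x∈)  = Sum.map₁ there (◅◅-visited s t x∈)

  -- Where two paths diverge, their remainders close up to a cycle.
  path-unique : Acyclic → (p q : Path u v) → onPath p ≡ onPath q
  path-unique {u} {v} acyc (s , us) (t , ut) = go s us t ut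
    where
    go : ∀ {u} (s : Star _~_ u v) → Unique (visited s) →
         (t : Star _~_ u v) → Unique (visited t) → visited s ≡ visited t
    go ε _ ε _ = refl
    go ε _ (_ ◅ t) (u∉t ∷ _) = contradiction (end∈ t) (All¬⇒¬Any u∉t)
    go (_ ◅ s) (u∉s ∷ _) ε _ = contradiction (end∈ s) (All¬⇒¬Any u∉s)
    go {u} (_◅_ {j = x} e s) (u∉s ∷ us) (_◅_ {j = y} e′ t) (u∉t ∷ ut)
      with _≟ᵛ_ A x y
    ... | yes refl = cong (u ∷_) (go s us t ut)
    ... | no x≢y with erase (s ◅◅ reversed t)
    ...   | r , r⊆ = contradiction (symmetric e′) (acyc (extend e r u∉r) (long r))
      where
      u∉r : u ∉ onPath r
      u∉r u∈r = [ All¬⇒¬Any u∉s , All¬⇒¬Any u∉t ∘ reversed-visited t ]′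
                  (◅◅-visited s (reversed t) (r⊆ u∈r))
      long : (r : Path x y) → 3 ≤ length (u ∷ onPath r)
      long (ε , _)           = contradiction refl x≢y
      long (_ ◅ ε , _)       = s≤s (s≤s (s≤s z≤n))
      long (_ ◅ (_ ◅ _) , _) = s≤s (s≤s (s≤s z≤n))

  visited-head : ∀ {x x′} (s : Star _~_ x v) (t : Star _~_ x′ w) →
                 visited s ≡ visited t → x ≡ x′
  visited-head ε       ε       = ∷-injectiveˡ
  visited-head ε       (_ ◅ _) = ∷-injectiveˡ
  visited-head (_ ◅ _) ε       = ∷-injectiveˡ
  visited-head (_ ◅ _) (_ ◅ _) = ∷-injectiveˡ

  second-unique : Acyclic → (p q : Path u v) → second p ≡ second q
  second-unique acyc p q = go p q (path-unique acyc p q)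
    where
    go : (p q : Path u v) → onPath p ≡ onPath q → second p ≡ second q
    go (ε , _)     (ε , _)           _  = refl
    go (ε , _)     (_ ◅ t , u∉t ∷ _) _  = contradiction (end∈ t) (All¬⇒¬Any u∉t)
    go (_ ◅ s , u∉s ∷ _) (ε , _)     _  = contradiction (end∈ s) (All¬⇒¬Any u∉s)
    go (_ ◅ s , _) (_ ◅ t , _)       eq = visited-head s t (∷-injectiveʳ eq)

module Fathers {A : LabelSet} (t : Tree A) where
  open Tree t
  open Walks graph

  private variable
    u v w x : Vertex A

  -- Frees `father` from the path chosen by `connected`, so that tails and extensions of paths can
  -- be used to compute it.
  father-second : (p : Path v (root A)) → father v ≡ second p
  father-second {v} p = second-unique acyclic (connected v (root A)) p

  father-root : father (root A) ≡ root A
  father-root = father-second (ε , [] ∷ [])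

  path⇒climb : (p : Path v (root A)) → x ∈ onPath p → Climb father v x
  path⇒climb (ε , _)            (here refl) = stop
  path⇒climb (e ◅ s , _)        (here refl) = stop
  path⇒climb (e ◅ s , v∉s ∷ us) (there x∈s) =
    climb-step (father-second (e ◅ s , v∉s ∷ us)) (path⇒climb (s , us) x∈s)

  reach : ∀ v → Climb father v (root A)
  reach v = path⇒climb (connected v (root A)) (end∈ (proj₁ (connected v (root A))))

  open Rooted (_≟ᵛ_ A) (root A) father father-root reach public

  climb⇒path : (p : Path v (root A)) → Climb father v x → x ∈ onPath p
  climb⇒path (s , _) stop = start∈ s
  climb⇒path (ε , _) c@(up _) = here (climb-root c)
  climb⇒path {x = x} (e ◅ s , v∉s ∷ us) (up c) = there $ climb⇒path (s , us) $
    subst (λ y → Climb father y x) (father-second (e ◅ s , v∉s ∷ us)) c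

  -- `Hook` reads the path from the root downwards, whereas climbs follow the path to the root.
  onPath-reversed : ∀ u v → onPath (connected u v) ⊆ onPath (connected v u)
  onPath-reversed u v with erase (reversed (proj₁ (connected v u)))
  ... | p , p⊆ = reversed-visited _ ∘ p⊆ ∘
    subst (_ ∈_) (path-unique acyclic (connected u v) p)

  hook⇒climb : Hook w u → Climb father u w
  hook⇒climb h = path⇒climb (connected _ (root A)) (onPath-reversed (root A) _ h)

  climb⇒hook : Climb father u w → Hook w u
  climb⇒hook c = onPath-reversed _ (root A) (climb⇒path (connected _ (root A)) c)

  father-adjacent : v ≢ root A → v ~ father v
  father-adjacent {v} v≢r with connected v (root A)
  ... | ε , _     = contradiction refl v≢r
  ... | e ◅ _ , _ = e

  -- If one end misses the root path of the other, prepending the edge gives its own root path. If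
  -- each lies on the root path of the other, antisymmetry identifies them.
  adjacent⇒link : u ~ v → Link father u v
  adjacent⇒link {u} {v} e = u≢v , child
    where
    open DecMembership (_≟ᵛ_ A) using (_∈?_)
    u≢v : u ≢ v
    u≢v refl = irreflexive e
    child : father u ≡ v ⊎ father v ≡ u
    child with u ∈? onPath (connected v (root A)) | v ∈? onPath (connected u (root A))
    ... | no u∉p  | _       =
      inj₁ (father-second (extend e (connected v (root A)) u∉p))
    ... | yes _   | no v∉p  =
      inj₂ (father-second (extend (symmetric e) (connected u (root A)) v∉p))
    ... | yes u∈p | yes v∈p = contradiction
      (climb-antisym (path⇒climb (connected u (root A)) v∈p)
                     (path⇒climb (connected v (root A)) u∈p)) u≢v

  link⇒adjacent : Link father u v → u ~ v
  link⇒adjacent {u} (u≢v , inj₁ refl) = father-adjacent λ where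
    refl → u≢v (sym father-root)
  link⇒adjacent (u≢v , inj₂ refl) = symmetric (father-adjacent λ where
    refl → u≢v father-root)

module FromFather {A : LabelSet} (f : Vertex A → Vertex A)
  (f-root : f (root A) ≡ root A) (reach : ∀ v → Climb f v (root A)) where

  open Rooted (_≟ᵛ_ A) (root A) f f-root reach

  private variable
    u v w x y : Vertex A

  link? : ∀ u v → Dec (Link f u v)
  link? u v = ¬? (_≟ᵛ_ A u v) ×-dec (_≟ᵛ_ A (f u) v ⊎-dec _≟ᵛ_ A (f v) u)

  graph : Graph A
  graph = record
    { adjacent    = λ u v → isYes (link? u v)
    ; symmetric   = λ {u} {v} e → fromWitness {a? = link? v u}
        (let u≢v , c = toWitness {a? = link? u v} e in u≢v ∘ sym , Sum.swap c)
    ; irreflexive = λ {v} e → proj₁ (toWitness {a? = link? v v} e) refl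
    }

  open Graph graph
  open Walks graph

  adjacent⇒link : u ~ v → Link f u v
  adjacent⇒link {u} {v} = toWitness {a? = link? u v}

  link⇒adjacent : Link f u v → u ~ v
  link⇒adjacent {u} {v} = fromWitness {a? = link? u v}

  climb⇒walk : Climb f u v → Star _~_ u v
  climb⇒walk stop = ε
  climb⇒walk {u} {v} (up c) with _≟ᵛ_ A u (f u)
  -- A climb may idle at the root, where there is no edge to follow.
  ... | yes u≡fu = subst (λ x → Star _~_ x v) (sym u≡fu) (climb⇒walk c)
  ... | no u≢fu  = link⇒adjacent (u≢fu , inj₁ refl) ◅ climb⇒walk c

  -- The subtree below w is joined to the rest by the edge from w to f w only.
  leave : (s : Star _~_ x y) → Climb f x w → ¬ Climb f y w → w ∈ visited s
  leave ε x↑w y↛w = contradiction x↑w y↛w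
  leave {w = w} (_◅_ {j = z} e s) x↑w y↛w with climb? z w
  ... | yes z↑w = there (leave s z↑w y↛w)
  ... | no z↛w with proj₂ (adjacent⇒link e) | x↑w
  ...   | inj₂ refl | _     = contradiction (up x↑w) z↛w
  ...   | inj₁ refl | stop  = here refl
  ...   | inj₁ refl | up c  = contradiction c z↛w

  enter : (s : Star _~_ x y) → ¬ Climb f x w → Climb f y w → f w ∈ visited s
  enter ε x↛w y↑w = contradiction y↑w x↛w
  enter {w = w} (_◅_ {j = z} e s) x↛w y↑w with climb? z w
  ... | no z↛w = there (enter s z↛w y↑w)
  ... | yes z↑w with proj₂ (adjacent⇒link e) | z↑w
  ...   | inj₁ refl | _     = contradiction (up z↑w) x↛w
  ...   | inj₂ refl | stop  = here refl
  ...   | inj₂ refl | up c  = contradiction c x↛w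

  -- The closing edge joins a child to its father. The path after `u` avoids `u`, so it can neither
  -- enter the subtree of `v` if `f v ≡ u` nor leave the subtree of `u` if `f u ≡ v`. The remaining
  -- positions of the second vertex `x` fail directly.
  acyclic : Acyclic
  acyclic (ε , _)     (s≤s ())
  acyclic (_ ◅ ε , _) (s≤s (s≤s ()))
  acyclic {u} {v} (_◅_ {j = x} e s@(_ ◅ s′) , u∉s ∷ x∉s′ ∷ _) _ e′
    with adjacent⇒link e | adjacent⇒link e′
  ... | u≢x , link | v≢u , inj₁ refl with climb? x v
  ...   | no x↛v  = All¬⇒¬Any u∉s (enter s x↛v stop)
  ...   | yes x↑v with link | x↑v
  ...     | inj₁ refl | _    = v≢u (climb-antisym (up stop) (up x↑v))
  ...     | inj₂ _    | stop = All¬⇒¬Any x∉s′ (end∈ s′)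
  ...     | inj₂ fx≡u | up c = v≢u
              (climb-antisym (up stop) (subst (λ y → Climb f y v) fx≡u c))
  acyclic {u} {v} (_◅_ {j = x} e s@(_ ◅ s′) , u∉s ∷ x∉s′ ∷ _) _ e′
      | u≢x , link | v≢u , inj₂ refl with climb? x u
  ...   | yes x↑u = All¬⇒¬Any u∉s (leave s x↑u λ v↑u → v≢u (climb-antisym v↑u (up stop)))
  ...   | no x↛u with link
  ...     | inj₁ refl = All¬⇒¬Any x∉s′ (end∈ s′)
  ...     | inj₂ refl = x↛u (up stop)

  tree : Tree A
  tree = record
    { graph     = graph
    ; connected = λ u v → proj₁ (erase
        (climb⇒walk (reach u) ◅◅ reversed (climb⇒walk (reach v))))
    ; acyclic   = acyclic
    }

  father≗f : Tree.father tree ≗ f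
  father≗f = Fathers.link-unique tree f-root
    (adjacent⇒link ∘ Fathers.link⇒adjacent tree)

T-extensional : ∀ {a b} → (T a → T b) → (T b → T a) → a ≡ b
T-extensional a⇒b b⇒a = ⇔→≡ (⇔.trans (⇔.sym T-≡) (⇔.trans (mk⇔ a⇒b b⇒a) T-≡))

link-cong : {V : Set} {f f′ : V → V} {u v : V} → f ≗ f′ → Link f u v → Link f′ u v
link-cong f≗ (u≢v , c) =
  u≢v , Sum.map (trans (sym (f≗ _))) (trans (sym (f≗ _))) c

-- The move on father functions

module _ (A : LabelSet) where
  private
    _≟V_ = _≟ᵛ_ A

  infix 4 _≺_ _≼_
  _≺_ _≼_ : Vertex A → Vertex A → Set
  u ≺ v = value u < value v
  u ≼ v = value u ≤ value v

  -- The mark g extends φ by the identity, so that a vertex v is moved iff g v ≢ v.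
  record Code : Set where
    field
      f g    : Vertex A → Vertex A
      f-root : f (root A) ≡ root A
      reach  : ∀ v → Climb f v (root A)
      g-root : g (root A) ≡ root A
      hook   : ∀ v → Climb f (g v) v
      g-≥    : ∀ v → v ≼ g v
      moved-path : ∀ {v x} → g v ≢ v → Climb f v x → x ≢ root A → f x ≺ x
      moved<decreasing : ∀ {u v} → v ≺ f v → g u ≢ u → u ≺ v

    open Rooted _≟V_ (root A) f f-root reach public

    moved≢root : ∀ {v} → g v ≢ v → v ≢ root A
    moved≢root m refl = m g-root

    -- Labels decrease along the path from a moved vertex to the root. A moved vertex smaller than
    -- some `w` therefore never has `w` above it.
    moved-climb : ∀ {v x} → g v ≢ v → Climb f v x → x ≼ v
    moved-climb m k = go (moved-path m) k
      where
      go : ∀ {v x} → (∀ {x} → Climb f v x → x ≢ root A → f x ≺ x) →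
           Climb f v x → x ≼ v
      go _ stop = ℕ.≤-refl
      go {v} inc (up k) with v ≟V root A
      ... | yes refl = ℕ.≤-reflexive (cong value (climb-root (up k)))
      ... | no v≢r   = ℕ.≤-trans (go (inc ∘ up) k) (ℕ.<⇒≤ (inc stop v≢r))

  infix 4 _≋_
  record _≋_ (C D : Code) : Set where
    constructor _,_
    field
      f≗ : Code.f C ≗ Code.f D
      g≗ : Code.g C ≗ Code.g D

  ≋-sym : ∀ {C D} → C ≋ D → D ≋ C
  ≋-sym (p , q) = sym ∘ p , sym ∘ q

  ≋-trans : ∀ {C D E} → C ≋ D → D ≋ E → C ≋ E
  ≋-trans (p , q) (p′ , q′) = (λ v → trans (p v) (p′ v)) , (λ v → trans (q v) (q′ v))

  -- D arises from C by the move of v.  The vertex c is determined by `child` and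
  -- `toward` from C, and by `toward′`, `v≺c` and `above` from D.
  record Step (C D : Code) : Set where
    private
      module C = Code C
      module D = Code D
    field
      v c            : Vertex A
      moved          : C.g v ≢ v
      moved-max      : ∀ {x} → C.g x ≢ x → x ≼ v
      decreasing     : v ≺ D.f v
      decreasing-min : ∀ {x} → x ≺ D.f x → v ≼ x
      child          : C.f c ≡ v
      toward         : Climb C.f (C.g v) c
      toward′        : Climb D.f (D.f v) c
      v≺c            : v ≺ c
      above          : ∀ {x} → Climb D.f (D.f c) x → x ≼ v
      f′v            : D.f v ≡ C.g v
      f′c            : D.f c ≡ C.f v
      f-agree        : ∀ {x} → x ≢ v → x ≢ c → D.f x ≡ C.f x
      g′v            : D.g v ≡ v
      g-agree        : ∀ {x} → x ≢ v → D.g x ≡ C.g x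

  root-min : ∀ v → root A ≼ v
  root-min (Refinement._,_ a [ a∈ ]) =
    go (LabelSet.labels A) (LabelSet.ascending A)
       -- The membership proof stored in a vertex is irrelevant; decidability restores one that can
       -- be analysed.
       (recompute (DecMembership._∈?_ ℕ._≟_ a _) a∈)
    where
    go : (l : List⁺ ℕ) → AllPairs _<_ (toList l) → a ∈ toList l → head l ≤ a
    go (x ∷⁺ xs) _        (here refl) = ℕ.≤-refl
    go (x ∷⁺ xs) (x< ∷ _) (there a∈) = ℕ.<⇒≤ (All.lookup x< a∈)

  ≼-antisym : ∀ {u v} → u ≼ v → v ≼ u → u ≡ v
  ≼-antisym p q = value-injective (ℕ.≤-antisym p q)

  ≼∧≢⇒≺ : ∀ {u v} → u ≼ v → u ≢ v → u ≺ v
  ≼∧≢⇒≺ p u≢v = ℕ.≤∧≢⇒< p (u≢v ∘ value-injective)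

  -- Uniqueness of the move in both directions

  step-functional : ∀ {C C′ D D′} → C ≋ C′ → Step C D → Step C′ D′ → D ≋ D′
  step-functional {C} {C′} {D} {D′} (f≗ , g≗) S S′ = f′≗ , g′≗
    where
    module C = Code C
    module D = Code D
    module D′ = Code D′
    module S = Step S
    module S′ = Step S′

    v≡ : S.v ≡ S′.v
    v≡ = ≼-antisym
      (S′.moved-max (S.moved ∘ trans (g≗ _)))
      (S.moved-max (S′.moved ∘ trans (sym (g≗ _))))

    child′ : C.f S′.c ≡ S.v
    child′ = trans (f≗ _) (trans S′.child (sym v≡))

    toward′ : Climb C.f (C.g S.v) S′.c
    toward′ = climb-agree (λ _ → sym (f≗ _))
      (subst (λ x → Climb (Code.f C′) x S′.c)
        (trans (cong (Code.g C′) (sym v≡)) (sym (g≗ _))) S′.toward)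

    v≢root : S.v ≢ root A
    v≢root = C.moved≢root S.moved

    -- A proper climb from `c` to `c′` passes through `v`, while `c′` climbs to `v`. Then `c′ ≡ v`,
    -- and `v` would be its own father.
    same : ∀ {c c′} → C.f c ≡ S.v → C.f c′ ≡ S.v → Climb C.f c c′ → c ≡ c′
    same _  _   stop   = refl
    same fc fc′ (up k) = contradiction
      (C.fixed⇒root (trans (cong C.f v≡c′) fc′)) v≢root
      where v≡c′ = C.climb-antisym (subst (λ x → Climb C.f x _) fc k) (step fc′)

    c≡ : S.c ≡ S′.c
    c≡ = [ same S.child child′ , sym ∘ same child′ S.child ]′
           (comparable S.toward toward′)

    f′≗ : D.f ≗ D′.f
    f′≗ x with x ≟V S.v | x ≟V S.c
    ... | yes refl | _ = trans S.f′v (trans (g≗ _)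
      (trans (cong (Code.g C′) v≡) (trans (sym S′.f′v) (cong D′.f (sym v≡)))))
    ... | no _ | yes refl = trans S.f′c (trans (f≗ _)
      (trans (cong (Code.f C′) v≡) (trans (sym S′.f′c) (cong D′.f (sym c≡)))))
    ... | no x≢v | no x≢c = trans (S.f-agree x≢v x≢c) (trans (f≗ x)
      (sym (S′.f-agree (x≢v ∘ λ e → trans e (sym v≡)) (x≢c ∘ λ e → trans e (sym c≡)))))

    g′≗ : D.g ≗ D′.g
    g′≗ x with x ≟V S.v
    ... | yes refl = trans S.g′v (trans v≡ (trans (sym S′.g′v) (cong D′.g (sym v≡))))
    ... | no x≢v   = trans (S.g-agree x≢v) (trans (g≗ x)
      (sym (S′.g-agree (x≢v ∘ λ e → trans e (sym v≡)))))

  step-injective : ∀ {C C′ D D′} → D ≋ D′ → Step C D → Step C′ D′ → C ≋ C′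
  step-injective {C} {C′} {D} {D′} (f≗ , g≗) S S′ = f′≗ , g′≗
    where
    module C = Code C
    module C′ = Code C′
    module D = Code D
    module D′ = Code D′
    module S = Step S
    module S′ = Step S′

    v≡ : S.v ≡ S′.v
    v≡ = ≼-antisym
      (S.decreasing-min (subst (S′.v ≺_) (sym (f≗ _)) S′.decreasing))
      (S′.decreasing-min (subst (S.v ≺_) (f≗ _) S.decreasing))

    toward′ : Climb D.f (D.f S.v) S′.c
    toward′ = climb-agree (λ _ → sym (f≗ _))
      (subst (λ x → Climb D′.f x S′.c)
        (trans (cong D′.f (sym v≡)) (sym (f≗ _))) S′.toward′)

    above′ : ∀ {x} → Climb D.f (D.f S′.c) x → x ≼ S.v
    above′ {x} k = subst (x ≼_) (sym v≡) (S′.above (climb-agree (λ _ → f≗ _)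
      (subst (λ y → Climb D.f y x) (f≗ _) k)))

    -- If `c′` were properly above `c`, the bound `above` would contradict `v≺c′`.
    same : ∀ {c c′} → (∀ {x} → Climb D.f (D.f c) x → x ≼ S.v) → S.v ≺ c′ →
           Climb D.f c c′ → c ≡ c′
    same _     _    stop   = refl
    same above v≺c′ (up k) = contradiction (above k) (ℕ.<⇒≱ v≺c′)

    c≡ : S.c ≡ S′.c
    c≡ = [ same S.above (subst (_≺ S′.c) (sym v≡) S′.v≺c)
         , sym ∘ same above′ S.v≺c ]′ (comparable S.toward′ toward′)

    f′≗ : C.f ≗ C′.f
    f′≗ x with x ≟V S.v | x ≟V S.c
    ... | yes refl | _ = trans (sym S.f′c) (trans (f≗ _)
      (trans (cong D′.f c≡) (trans S′.f′c (cong C′.f (sym v≡)))))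
    ... | no _ | yes refl = trans S.child (trans v≡
      (trans (sym S′.child) (cong C′.f (sym c≡))))
    ... | no x≢v | no x≢c = trans (sym (S.f-agree x≢v x≢c)) (trans (f≗ x)
      (S′.f-agree (x≢v ∘ λ e → trans e (sym v≡)) (x≢c ∘ λ e → trans e (sym c≡))))

    g′≗ : C.g ≗ C′.g
    g′≗ x with x ≟V S.v
    ... | yes refl = trans (sym S.f′v) (trans (f≗ _)
      (trans (cong D′.f v≡) (trans S′.f′v (cong C′.g (sym v≡)))))
    ... | no x≢v   = trans (sym (S.g-agree x≢v)) (trans (g≗ x)
      (S′.g-agree (x≢v ∘ λ e → trans e (sym v≡))))

  -- Existence of the move in both directions

  step-total : ∀ C v → Code.g C v ≢ v → (∀ {x} → Code.g C x ≢ x → x ≼ v) →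
               Σ[ D ∈ Code ] Step C D
  step-total C v moved max = D , record
    { v = v ; c = c ; moved = moved ; moved-max = max
    ; decreasing     = subst (v ≺_) (sym f′v) v≺gv
    -- An old decreasing vertex exceeds `v` by `moved<decreasing`, since `v` was moved.
    ; decreasing-min = λ d → [ ℕ.≤-reflexive ∘ cong value ∘ sym
                             , (λ (_ , d) → ℕ.<⇒≤ (moved<decreasing d moved)) ]′ (dec′ d)
    ; child = fc≡v
    ; toward  = gv↑c
    ; toward′ = subst (λ x → Climb f′ x c) (sym f′v) (climb-c gv↑c)
    ; v≺c = v≺c
    -- What lies above `c` now is what lay above the moved vertex `v` before.
    ; above = λ k → moved-climb moved
        (up (climb⁻ fv↛v (subst (λ x → Climb f′ x _) f′c k)))
    ; f′v = f′v ; f′c = f′c ; f-agree = f-agree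
    ; g′v = g′v ; g-agree = g-agree
    }
    where
    open Code C
    c = proj₁ (below _≟V_ (hook v) moved)
    gv↑c = proj₁ (proj₂ (below _≟V_ (hook v) moved))
    fc≡v = proj₂ (proj₂ (below _≟V_ (hook v) moved))

    v≢root : v ≢ root A
    v≢root = moved≢root moved

    c≢v : c ≢ v
    c≢v c≡v = v≢root (fixed⇒root (trans (cong f (sym c≡v)) fc≡v))

    v≺gv : v ≺ g v
    v≺gv = ≼∧≢⇒≺ (g-≥ v) (moved ∘ sym)

    fv≺v : f v ≺ v
    fv≺v = moved-path moved stop v≢root

    v≺c : v ≺ c
    v≺c with ℕ.<-cmp (value v) (value c)
    ... | tri< v<c _ _ = v<c
    ... | tri≈ _ v≡c _ = contradiction (sym (value-injective v≡c)) c≢v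
    -- This case is not refuted: `c` would be decreasing, so `moved<decreasing` returns the claim
    -- itself.
    ... | tri> _ _ c<v = moved<decreasing (subst (c ≺_) (sym fc≡v) c<v) moved

    f′ = update _≟V_ (update _≟V_ f c (f v)) v (g v)
    g′ = update _≟V_ g v v

    f′v : f′ v ≡ g v
    f′v = update-at _≟V_ _ v (g v)

    f′c : f′ c ≡ f v
    f′c = trans (update-off _≟V_ _ v (g v) c≢v) (update-at _≟V_ f c (f v))

    f-agree : ∀ {x} → x ≢ v → x ≢ c → f′ x ≡ f x
    f-agree x≢v x≢c = trans (update-off _≟V_ _ v (g v) x≢v)
                            (update-off _≟V_ f c (f v) x≢c)

    g′v : g′ v ≡ v
    g′v = update-at _≟V_ g v v

    g-agree : ∀ {x} → x ≢ v → g′ x ≡ g x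
    g-agree = update-off _≟V_ g v v

    open Cut _≟V_ (root A) f f′ f-root reach v c v≢root fc≡v f′c
      (subst (λ x → Climb f x c) (sym f′v) gv↑c) f-agree

    moved′ : ∀ {x} → g′ x ≢ x → g x ≢ x × x ≺ v
    moved′ {x} m with x ≟V v
    ... | yes refl = contradiction refl m
    ... | no x≢v   = m , ≼∧≢⇒≺ (max m) x≢v

    dec′ : ∀ {x} → x ≺ f′ x → x ≡ v ⊎ x ≢ v × x ≺ f x
    dec′ {x} d with x ≟V v
    ... | yes x≡v = inj₁ x≡v
    ... | no x≢v with x ≟V c
    ...   | yes refl = contradiction d (ℕ.<⇒≯ (ℕ.<-trans fv≺v v≺c))
    ...   | no _     = inj₂ (x≢v , d)

    -- The maximality of `v` enters here, and confines the paths of the remaining moved vertices to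
    -- unchanged fathers.
    moved↛v : ∀ {x} → g′ x ≢ x → ¬ Climb f x v
    moved↛v m k = let m₀ , x≺v = moved′ m in ℕ.<⇒≱ x≺v (moved-climb m₀ k)

    hook′ : ∀ x → Climb f′ (g′ x) x
    hook′ x with x ≟V v
    ... | yes refl = stop
    ... | no x≢v   = climb′ x≢v (hook x)

    g′-≥ : ∀ x → x ≼ g′ x
    g′-≥ x with x ≟V v
    ... | yes refl = ℕ.≤-refl
    ... | no x≢v   = g-≥ x

    D : Code
    D = record
      { f = f′ ; g = g′
      ; f-root = f′-root
      ; reach  = reach′
      ; g-root = trans (g-agree (v≢root ∘ sym)) g-root
      ; hook = hook′
      ; g-≥  = g′-≥
      ; moved-path = λ {_} {x} m k x≢r →
          let k₀ = climb⁻ (moved↛v m) k in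
          subst (_≺ x) (outside (moved↛v m) k₀)
            (moved-path (proj₁ (moved′ m)) k₀ x≢r)
      ; moved<decreasing = λ d m → let m₀ , u≺v = moved′ m in
          [ (λ { refl → u≺v }) , (λ (_ , d) → moved<decreasing d m₀) ]′ (dec′ d)
      }

  step-onto : ∀ D v → v ≺ Code.f D v → (∀ {x} → x ≺ Code.f D x → v ≼ x) →
              Σ[ C ∈ Code ] Step C D
  step-onto D v dec min = C , record
    { v = v ; c = c
    ; moved = λ e → ℕ.<-irrefl (sym (cong value (trans (sym gv) e))) dec
    ; moved-max = λ m → [ ℕ.≤-reflexive ∘ cong value , ℕ.<⇒≤ ∘ proj₂ ]′ (moved′ m)
    ; decreasing = dec
    ; decreasing-min = min
    ; child = f′c
    ; toward = subst (λ x → Climb f′ x c) (sym gv) (climb-c (fv↛v) fv↑c)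
    ; toward′ = fv↑c
    ; v≺c = v≺c
    ; above = above
    ; f′v = sym gv ; f′c = sym f′v
    ; f-agree = λ x≢v x≢c → sym (f-agree x≢v x≢c)
    ; g′v = g≡v
    ; g-agree = sym ∘ g-agree
    }
    where
    open Code D

    Crossing : Vertex A → Set
    Crossing z = Σ[ c ∈ Vertex A ]
      Climb f z c × v ≺ c × (∀ {x} → Climb f (f c) x → x ≼ v)

    -- The ancestors of `z` are examined before `z`, so the crossing found is the one nearest the
    -- root. The left alternative carries the bound needed to make the next vertex a crossing.
    search : ∀ {z} → Climb f z (root A) → (∀ {x} → Climb f z x → x ≼ v) ⊎ Crossing z
    search stop = inj₁ λ k → subst (_≼ v) (sym (climb-root k)) (root-min v)
    search {z} (up k) with search k
    ... | inj₂ (c , fz↑c , cross) = inj₂ (c , up fz↑c , cross)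
    ... | inj₁ fz≼v with value z ≤? value v
    ...   | no z⋠v  = inj₂ (z , stop , ℕ.≰⇒> z⋠v , fz≼v)
    ...   | yes z≼v = inj₁ λ { stop → z≼v ; (up l) → fz≼v l }

    crossing : Crossing (f v)
    crossing = [ (λ below → contradiction dec (ℕ.≤⇒≯ (below stop))) , id ]′
                 (search (reach (f v)))

    c = proj₁ crossing
    fv↑c : Climb f (f v) c
    fv↑c = proj₁ (proj₂ crossing)
    v≺c : v ≺ c
    v≺c = proj₁ (proj₂ (proj₂ crossing))
    above : ∀ {x} → Climb f (f c) x → x ≼ v
    above = proj₂ (proj₂ (proj₂ crossing))

    c≢v : c ≢ v
    c≢v c≡v = ℕ.<-irrefl (cong value (sym c≡v)) v≺c

    v≢root : v ≢ root A
    v≢root refl = ℕ.<-irrefl (cong value (sym f-root)) dec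

    c≢root : c ≢ root A
    c≢root c≡r = ℕ.<⇒≱ v≺c (subst (_≼ v) (sym c≡r) (root-min v))

    -- Equality is impossible because `v` lies below `c`.
    above-≺ : ∀ {x} → Climb f (f c) x → x ≺ v
    above-≺ {x} k = ≼∧≢⇒≺ (above k) x≢v
      where
      x≢v : x ≢ v
      x≢v refl = c≢v (climb-antisym (up k) (up fv↑c))

    above-increasing : ∀ {x} → Climb f (f c) x → x ≢ root A → f x ≺ x
    above-increasing {x} k x≢r with ℕ.<-cmp (value (f x)) (value x)
    ... | tri< inc _ _ = inc
    ... | tri≈ _ eq _  = contradiction (fixed⇒root (value-injective eq)) x≢r
    ... | tri> _ _ d   = contradiction (min d) (ℕ.<⇒≱ (above-≺ k))

    fv↛v : ¬ Climb f (f v) v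
    fv↛v k = v≢root (fixed⇒root (climb-antisym k (up stop)))

    f′ = update _≟V_ (update _≟V_ f c v) v (f c)
    g′ = update _≟V_ g v (f v)

    f′v : f′ v ≡ f c
    f′v = update-at _≟V_ _ v (f c)

    f′c : f′ c ≡ v
    f′c = trans (update-off _≟V_ _ v (f c) c≢v) (update-at _≟V_ f c v)

    f-agree : ∀ {x} → x ≢ v → x ≢ c → f′ x ≡ f x
    f-agree x≢v x≢c = trans (update-off _≟V_ _ v (f c) x≢v)
                            (update-off _≟V_ f c v x≢c)

    gv : g′ v ≡ f v
    gv = update-at _≟V_ g v (f v)

    g-agree : ∀ {x} → x ≢ v → g′ x ≡ g x
    g-agree = update-off _≟V_ g v (f v)

    -- By `moved<decreasing`, a vertex both moved and decreasing would be smaller than itself.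
    g≡v : g v ≡ v
    g≡v with g v ≟V v
    ... | yes eq = eq
    ... | no m   = contradiction (moved<decreasing dec m) (ℕ.<-irrefl refl)

    open Paste _≟V_ (root A) f f′ f-root reach v c v≢root (c≢v ∘ sym) c≢root
      f′v f′c fv↑c f-agree

    moved′ : ∀ {x} → g′ x ≢ x → x ≡ v ⊎ g x ≢ x × x ≺ v
    moved′ {x} m with x ≟V v
    ... | yes x≡v = inj₁ x≡v
    ... | no x≢v  = inj₂ (m , moved<decreasing dec m)

    dec′ : ∀ {x} → x ≺ f′ x → x ≢ v × x ≺ f x
    dec′ {x} d with x ≟V v
    ... | yes refl = contradiction d (ℕ.<⇒≯ (above-≺ stop))
    ... | no x≢v with x ≟V c
    ...   | yes refl = contradiction d (ℕ.<⇒≯ v≺c)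
    ...   | no _     = x≢v , d

    -- Old moved vertices are smaller than the decreasing `v`, hence than `c`, and their ancestors
    -- are no larger than they are.
    moved↛c : ∀ {x} → g x ≢ x → ¬ Climb f x c
    moved↛c m k = ℕ.<⇒≱ (ℕ.<-trans (moved<decreasing dec m) v≺c) (moved-climb m k)

    hook′ : ∀ x → Climb f′ (g′ x) x
    hook′ x with x ≟V v
    ... | yes refl = fv↑v
    -- An unmoved `x` may lie below `c`, beyond the scope of `climb′`, but there the mark is `x`
    -- itself.
    ... | no x≢v with g x ≟V x
    ...   | yes eq = subst (λ y → Climb f′ y x) (sym eq) stop
    ...   | no m   = climb′ (moved↛c m) (hook x)

    g′-≥ : ∀ x → x ≼ g′ x
    g′-≥ x with x ≟V v
    ... | yes refl = ℕ.<⇒≤ dec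
    ... | no x≢v   = g-≥ x

    moved-path′ : ∀ {w x} → g′ w ≢ w → Climb f′ w x → x ≢ root A → f′ x ≺ x
    moved-path′ {w} {x} m k x≢r with moved′ m
    ... | inj₂ (m₀ , _) = let k₀ = climb⁻ (moved↛c m₀) k in
      subst (_≺ x) (outside (moved↛c m₀) k₀) (moved-path m₀ k₀ x≢r)
    -- The new path of `v` continues with the old path above `c`, whose vertices are increasing.
    ... | inj₁ refl with k
    ...   | stop = subst (_≺ v) (sym f′v) (above-≺ stop)
    ...   | up l = let l₀ = climb⁻ fc↛c (subst (λ y → Climb f′ y x) f′v l) in
      subst (_≺ x) (outside fc↛c l₀) (above-increasing l₀ x≢r)

    moved<decreasing′ : ∀ {u w} → w ≺ f′ w → g′ u ≢ u → u ≺ w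
    moved<decreasing′ d m with dec′ d | moved′ m
    ... | w≢v , d₀ | inj₁ refl     = ≼∧≢⇒≺ (min d₀) (w≢v ∘ sym)
    ... | _   , d₀ | inj₂ (m₀ , _) = moved<decreasing d₀ m₀

    C : Code
    C = record
      { f = f′ ; g = g′
      ; f-root = f′-root
      ; reach  = reach′
      ; g-root = trans (g-agree (v≢root ∘ sym)) g-root
      ; hook = hook′
      ; g-≥  = g′-≥
      ; moved-path = moved-path′
      ; moved<decreasing = moved<decreasing′
      }

  -- Counts and weight under the move

  open LabelSet A

  map-value-vertices : map value (vertices A) ≡ toList labels
  map-value-vertices = trans (map-mapWith∈ (toList labels)
    (λ {a} a∈A → Refinement._,_ a [ a∈A ]) value)
    (mapWith∈-id (toList labels))

  vertices-complete : ∀ v → v ∈ vertices A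
  vertices-complete v@(Refinement._,_ a [ a∈ ])
    with ∈-map⁻ value (subst (a ∈_) (sym map-value-vertices)
                             (recompute (DecMembership._∈?_ ℕ._≟_ a _) a∈))
  ... | w , w∈ , a≡w = subst (_∈ vertices A) (value-injective (sym a≡w)) w∈

  vertices-unique : Unique (vertices A)
  vertices-unique = Unique.map⁻ (subst Unique (sym map-value-vertices)
    (AllPairs.map ℕ.<⇒≢ ascending))

  module _ (C : Code) where
    open Code C

    codeDecreasing? : Decidable (λ w → w ≺ f w)
    codeDecreasing? w = value w <? value (f w)

    codeMoved? : Decidable (λ w → g w ≢ w)
    codeMoved? w = ¬? (g w ≟V w)

    #codeDecreasing #codeMoved : ℕ
    #codeDecreasing = length (filter codeDecreasing? (vertices A))
    #codeMoved      = length (filter codeMoved? (vertices A))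

  -- The case distinction of `factor` with father and mark as plain arguments, so that both can be
  -- rewritten; irrelevance of the inequality makes this harmless.
  factorAt : (w a b : Vertex A) → .(w ≼ b) → Monomial A
  factorAt w a b w≼b with <-cmp (value a) (value w)
  ... | tri< _ _ _   = x⟨ a ⟩ ∷ y⟨ w , b ⟩[ w≼b ] ∷ []
  ... | tri≈ _ _ _   = []
  ... | tri> _ _ dec = x⟨ w ⟩ ∷ y⟨ w , a ⟩[ ℕ.<⇒≤ dec ] ∷ []

  factorAt-increasing : ∀ {w a b} .(w≼b : w ≼ b) → a ≺ w →
    factorAt w a b w≼b ≡ x⟨ a ⟩ ∷ y⟨ w , b ⟩[ w≼b ] ∷ []
  factorAt-increasing {w} {a} w≼b a≺w with <-cmp (value a) (value w)
  ... | tri< _ _ _    = refl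
  ... | tri≈ a⊀w _ _  = contradiction a≺w a⊀w
  ... | tri> a⊀w _ _  = contradiction a≺w a⊀w

  factorAt-decreasing : ∀ {w a b} .(w≼b : w ≼ b) (w≺a : w ≺ a) →
    factorAt w a b w≼b ≡ x⟨ w ⟩ ∷ y⟨ w , a ⟩[ ℕ.<⇒≤ w≺a ] ∷ []
  factorAt-decreasing {w} {a} w≼b w≺a with <-cmp (value a) (value w)
  ... | tri< _ _ w⊀a  = contradiction w≺a w⊀a
  ... | tri≈ _ _ w⊀a  = contradiction w≺a w⊀a
  ... | tri> _ _ _    = refl

  factorAt-cong : ∀ {w a a′ b b′} .{p : w ≼ b} .{q : w ≼ b′} →
    a ≡ a′ → b ≡ b′ → factorAt w a b p ≡ factorAt w a′ b′ q
  factorAt-cong refl refl = refl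

  codeFactor : Code → Vertex A → Monomial A
  codeFactor C w = factorAt w (f w) (g w) (g-≥ w)
    where open Code C

  weight : Code → Monomial A
  weight C = concatMap (codeFactor C) (vertices A)

  weight-cong : ∀ {C D} → C ≋ D → weight C ≡ weight D
  weight-cong (f≗ , g≗) =
    concatMap-cong (λ w → factorAt-cong (f≗ w) (g≗ w)) (vertices A)

  module _ {C D : Code} (S : Step C D) where
    private
      module C = Code C
      module D = Code D
    open Step S

    private
      v≢root : v ≢ root A
      v≢root = C.moved≢root moved

      fv≺v : C.f v ≺ v
      fv≺v = C.moved-path moved stop v≢root

      c≢v : c ≢ v
      c≢v c≡v = ℕ.<-irrefl (cong value (sym c≡v)) v≺c

      fv≺c : C.f v ≺ c
      fv≺c = ℕ.<-trans fv≺v v≺c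

    step-#decreasing : #codeDecreasing D ≡ suc (#codeDecreasing C)
    step-#decreasing = length-filter-insert (codeDecreasing? C) (codeDecreasing? D)
      vertices-unique (vertices-complete v) (ℕ.<⇒≯ fv≺v) decreasing iff
      where
      iff : ∀ {x} → x ≢ v → (x ≺ C.f x → x ≺ D.f x) ×
                            (x ≺ D.f x → x ≺ C.f x)
      iff {x} x≢v with x ≟V c
      ... | yes refl = (λ d → contradiction (subst (c ≺_) child d) (ℕ.<⇒≯ v≺c))
                     , (λ d → contradiction (subst (c ≺_) f′c d) (ℕ.<⇒≯ fv≺c))
      ... | no x≢c   = subst (x ≺_) (sym (f-agree x≢v x≢c))
                     , subst (x ≺_) (f-agree x≢v x≢c)

    step-#moved : #codeMoved C ≡ suc (#codeMoved D)
    step-#moved = length-filter-insert (codeMoved? D) (codeMoved? C)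
      vertices-unique (vertices-complete v) (λ m → m g′v) moved
      λ x≢v → (_∘ trans (g-agree x≢v)) , (_∘ trans (sym (g-agree x≢v)))

    step-weight : weight C ↭ weight D
    step-weight = concatMap-exchange (codeFactor C) (codeFactor D)
      vertices-unique (vertices-complete v) (vertices-complete c) c≢v exchange
      λ x≢v x≢c → factorAt-cong (sym (f-agree x≢v x≢c)) (sym (g-agree x≢v))
      where
      v≼gv : v ≼ C.g v
      v≼gv = C.g-≥ v
      c≼gc : c ≼ C.g c
      c≼gc = C.g-≥ c
      v≺gv : v ≺ C.g v
      v≺gv = subst (v ≺_) f′v decreasing
      exchange : codeFactor C v ++ codeFactor C c ↭ codeFactor D v ++ codeFactor D c
      exchange = begin
        codeFactor C v ++ codeFactor C c
          ≡⟨ cong₂ _++_ (factorAt-increasing v≼gv fv≺v)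
               (trans (factorAt-cong {q = c≼gc} child refl)
                      (factorAt-increasing c≼gc v≺c)) ⟩
        x⟨ C.f v ⟩ ∷ y⟨ v , C.g v ⟩[ v≼gv ] ∷ x⟨ v ⟩ ∷ y⟨ c , C.g c ⟩[ c≼gc ] ∷ []
          -- Three adjacent transpositions exchange the first and the third indeterminate.
          ↭⟨ ↭-trans (↭-swap _ _ ↭-refl)
               (↭-trans (↭-prep _ (↭-swap _ _ ↭-refl)) (↭-swap _ _ ↭-refl)) ⟩
        x⟨ v ⟩ ∷ y⟨ v , C.g v ⟩[ v≼gv ] ∷ x⟨ C.f v ⟩ ∷ y⟨ c , C.g c ⟩[ c≼gc ] ∷ []
          ≡⟨ cong₂ _++_
               (trans (factorAt-cong {p = D.g-≥ v} {q = D.g-≥ v} f′v refl)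
                      (factorAt-decreasing (D.g-≥ v) v≺gv))
               (trans (factorAt-cong {p = D.g-≥ c} {q = c≼gc} f′c (g-agree c≢v))
                      (factorAt-increasing c≼gc fv≺c)) ⟨
        codeFactor D v ++ codeFactor D c ∎
        where
        open PermutationReasoning

  -- Translation between pairs and codes

  module _ {i j : ℕ} (P : 𝓛 A i j) where
    open 𝓛 P
    private module F = Fathers tree

    totalMark : Vertex A → Vertex A
    totalMark v with increasing? v
    ... | yes inc = φ (v , inc)
    ... | no _    = v

    totalMark-increasing : ∀ {v} (inc : Increasing v) → totalMark v ≡ φ (v , inc)
    totalMark-increasing {v} inc with increasing? v
    ... | yes inc′ = cong (λ p → φ (v , p)) (ℕ.<-irrelevant inc′ inc)
    ... | no ¬inc  = contradiction inc ¬inc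

    marked⇒moved : ∀ {v} → totalMark v ≢ v → Moved v
    marked⇒moved {v} m with increasing? v
    ... | yes inc = inc , m
    ... | no _    = contradiction refl m

    moved⇒marked : ∀ {v} → Moved v → totalMark v ≢ v
    moved⇒marked (inc , m) = m ∘ trans (sym (totalMark-increasing inc))

    encode : Code
    encode = record
      { f = father
      ; g = totalMark
      ; f-root = F.father-root
      ; reach  = F.reach
      ; g-root = mark-root
      ; hook = hook
      ; g-≥  = mark-≥
      ; moved-path = λ {v} {x} m k x≢r → moved-path v (marked⇒moved m) x
          (F.climb⇒path (connected v (root A)) k) x≢r
      ; moved<decreasing = λ d m → moved<decreasing _ _ d (marked⇒moved m)
      }
      where
      mark-root : totalMark (root A) ≡ root A
      mark-root with increasing? (root A)
      ... | yes inc = contradiction inc (ℕ.<-irrefl (cong value F.father-root))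
      ... | no _    = refl
      hook : ∀ v → Climb father (totalMark v) v
      hook v with increasing? v
      ... | yes inc = F.hook⇒climb (φ-hook v inc)
      ... | no _    = stop
      mark-≥ : ∀ v → value v ≤ value (totalMark v)
      mark-≥ v with increasing? v
      ... | yes inc = φ-≥ v inc
      ... | no _    = ℕ.≤-refl

    encode-#moved : #codeMoved encode ≡ j
    encode-#moved = trans
      (cong length (filter-≐ (codeMoved? encode) moved?
        (marked⇒moved , moved⇒marked) (vertices A)))
      #moved

    encode-weight : ω A P ≡ weight encode
    encode-weight = concatMap-cong factor≡ (vertices A)
      where
      factor≡ : ∀ w → factor A P w ≡ codeFactor encode w
      factor≡ w with <-cmp (value (father w)) (value w)
      ... | tri< inc _ _ = y-cong (sym (totalMark-increasing inc))
        where
        y-cong : ∀ {a w b b′} .{p : value w ≤ value b} .{q : value w ≤ value b′} →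
          b ≡ b′ → _≡_ {A = Monomial A} (x⟨ a ⟩ ∷ y⟨ w , b ⟩[ p ] ∷ [])
                                        (x⟨ a ⟩ ∷ y⟨ w , b′ ⟩[ q ] ∷ [])
        y-cong refl = refl
      ... | tri≈ _ _ _ = refl
      ... | tri> _ _ _ = refl

  module _ {i j k l : ℕ} {P : 𝓛 A i j} {Q : 𝓛 A k l} where
    private
      module P = 𝓛 P
      module Q = 𝓛 Q
      module FP = Fathers P.tree
      module FQ = Fathers Q.tree

    ≈⇒≋ : _≈_ A P Q → encode P ≋ encode Q
    ≈⇒≋ e = father≗ , mark≗
      where
      open _≈_ e
      father≗ : P.father ≗ Q.father
      father≗ = FP.link-unique FQ.father-root λ {u} {v} →
        FQ.adjacent⇒link ∘ subst T (edges u v) ∘ FP.link⇒adjacent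
      mark≗ : totalMark P ≗ totalMark Q
      mark≗ v with P.increasing? v | Q.increasing? v
      ... | yes p | yes q = values v p q
      ... | yes p | no ¬q = contradiction (Equivalence.to (domain v) p) ¬q
      ... | no ¬p | yes q = contradiction (Equivalence.from (domain v) q) ¬p
      ... | no _  | no _  = refl

    ≋⇒≈ : encode P ≋ encode Q → _≈_ A P Q
    ≋⇒≈ (f≗ , g≗) = record
      { edges  = λ u v → T-extensional
          (FQ.link⇒adjacent ∘ link-cong f≗ ∘ FP.adjacent⇒link)
          (FP.link⇒adjacent ∘ link-cong (sym ∘ f≗) ∘ FQ.adjacent⇒link)
      ; domain = λ v → mk⇔ (subst (λ x → value x < value v) (f≗ v))
                           (subst (λ x → value x < value v) (sym (f≗ v)))
      ; values = λ v p q → trans (sym (totalMark-increasing P p))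
                                 (trans (g≗ v) (totalMark-increasing Q q))
      }

  module _ {i j : ℕ} (C : Code)
    (#dec : #codeDecreasing C ≡ i) (#mov : #codeMoved C ≡ j) where
    open Code C
    private
      module F = FromFather {A} f f-root reach
      module T = Tree F.tree
      module FT = Fathers F.tree

      φ : ∃ T.Increasing → Vertex A
      φ (v , _) = g v

      open Marking A F.tree φ

      toClimb : ∀ {u w} → Climb T.father u w → Climb f u w
      toClimb = climb-agree (λ _ → F.father≗f _)

      fromClimb : ∀ {u w} → Climb f u w → Climb T.father u w
      fromClimb = climb-agree (λ _ → sym (F.father≗f _))

      increasing : ∀ {v} → f v ≡ T.father v → f v ≺ v → T.Increasing v
      increasing {v} eq = subst (λ x → x ≺ v) eq

      moved⇒increasing : ∀ {v} → g v ≢ v → T.Increasing v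
      moved⇒increasing m =
        increasing (sym (F.father≗f _)) (moved-path m stop (moved≢root m))

      dec⇒ : ∀ {v} → T.Decreasing v → v ≺ f v
      dec⇒ {v} = subst (v ≺_) (F.father≗f v)

      dec⇐ : ∀ {v} → v ≺ f v → T.Decreasing v
      dec⇐ {v} = subst (v ≺_) (sym (F.father≗f v))

    decode : 𝓛 A i j
    decode = record
      { tree = F.tree
      ; φ    = φ
      ; φ-hook = λ v _ → FT.climb⇒hook (fromClimb (hook v))
      ; φ-≥    = λ v _ → g-≥ v
      ; moved-path = λ v (_ , m) u u∈ u≢r → increasing (sym (F.father≗f u))
          (moved-path m (toClimb (FT.path⇒climb (T.connected v (root A)) u∈)) u≢r)
      ; moved<decreasing = λ v u d (_ , m) → moved<decreasing (dec⇒ d) m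
      ; #decreasing = trans (cong length (filter-≐ T.decreasing? (codeDecreasing? C)
          (dec⇒ , dec⇐) (vertices A))) #dec
      ; #moved = trans (cong length (filter-≐ moved? (codeMoved? C)
          (proj₂ , λ m → moved⇒increasing m , m) (vertices A))) #mov
      }

    -- Restricting `g` to the increasing vertices loses nothing: `moved-path` at the vertex itself
    -- makes every moved vertex increasing.
    encode-decode : encode decode ≋ C
    encode-decode = F.father≗f , mark≗
      where
      mark≗ : totalMark decode ≗ g
      mark≗ v with T.increasing? v
      ... | yes _   = refl
      ... | no ¬inc with g v ≟V v
      ...   | yes gv≡v = sym gv≡v
      ...   | no m     = contradiction (moved⇒increasing m) ¬inc

  -- The weight-preserving bijection

  module _ {i j : ℕ} where

    -- Decoding builds a new tree whose fathers agree with those of `D` only pointwise, so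
    -- `encode Q` is tied to the step through `≋`.
    Image : 𝓛 A i (suc j) → 𝓛 A (suc i) j → Set
    Image P Q = Σ[ D ∈ Code ] Step (encode P) D × encode Q ≋ D

    image-step : ∀ P {D} → Step (encode P) D → ∃ (Image P)
    image-step P {D} S = decode D #dec #mov , D , S , encode-decode D #dec #mov
      where
      -- The decreasing count of `encode P` is that of `P` by definition; the moved count needs
      -- `encode-#moved`.
      #dec = trans (step-#decreasing S) (cong suc (𝓛.#decreasing P))
      #mov = ℕ.suc-injective (trans (sym (step-#moved S)) (encode-#moved P))

    image : ∀ P → ∃ (Image P)
    image P =
      let v , moved , max = maximal value (codeMoved? (encode P)) (vertices A)
                              vertices-complete (encode-#moved P)
      in image-step P (proj₂ (step-total (encode P) v moved max))

    Preimage : 𝓛 A (suc i) j → Set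
    Preimage Q = Σ[ P ∈ 𝓛 A i (suc j) ] Σ[ C ∈ Code ]
      Step C (encode Q) × encode P ≋ C

    preimage-step : ∀ Q {C} → Step C (encode Q) → Preimage Q
    preimage-step Q {C} S = decode C #dec #mov , C , S , encode-decode C #dec #mov
      where
      #dec = ℕ.suc-injective (trans (sym (step-#decreasing S)) (𝓛.#decreasing Q))
      #mov = trans (step-#moved S) (cong suc (encode-#moved Q))

    preimage : ∀ Q → Preimage Q
    preimage Q =
      let v , dec , min = minimal value (codeDecreasing? (encode Q)) (vertices A)
                            vertices-complete (𝓛.#decreasing Q)
      in preimage-step Q (proj₂ (step-onto (encode Q) v dec min))

    bijection : Bijection (𝓛-setoid A i (suc j)) (𝓛-setoid A (suc i) j)
    bijection = record
      { to   = proj₁ ∘ image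
      ; cong = λ {P} {P′} P≈P′ →
          let Q , D , S , Q≋D = image P
              Q′ , D′ , S′ , Q′≋D′ = image P′
          in ≋⇒≈ {P = Q} {Q = Q′} (≋-trans Q≋D (≋-trans
               (step-functional (≈⇒≋ P≈P′) S S′) (≋-sym Q′≋D′)))
      ; bijective =
          (λ {P} {P′} Q≈Q′ →
            let Q , D , S , Q≋D = image P
                Q′ , D′ , S′ , Q′≋D′ = image P′
            in ≋⇒≈ (step-injective (≋-trans (≋-sym Q≋D)
                 (≋-trans (≈⇒≋ Q≈Q′) Q′≋D′)) S S′))
        -- Surjectivity concerns every `P′ ≈ P`: functionality compares the step chosen for `P′`
        -- with the one that ends at `encode Q`.
        , λ Q → let P , C , S , P≋C = preimage Q in P , λ {P′} P′≈P →
            let Q′ , D , S′ , Q′≋D = image P′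
            in ≋⇒≈ (≋-trans Q′≋D
                 (step-functional (≋-trans (≈⇒≋ P′≈P) P≋C) S′ S))
      }

    bijection-weight : ∀ P → ω A P ↭ ω A (Bijection.to bijection P)
    bijection-weight P = let Q , D , S , Q≋D = image P in begin
      ω A P             ≡⟨ encode-weight P ⟩
      weight (encode P) ↭⟨ step-weight S ⟩
      weight D          ≡⟨ weight-cong Q≋D ⟨
      weight (encode Q) ≡⟨ encode-weight Q ⟨
      ω A Q             ∎
      where open PermutationReasoning

theorem2p1 : (A : LabelSet) (i j : ℕ) → j ≥ 1 →
    Σ[ f ∈ Bijection (𝓛-setoid A i j) (𝓛-setoid A (suc i) (j ∸ 1)) ]
    (∀ (P : 𝓛 A i j) → ω A P ↭ ω A (Bijection.to f P))
theorem2p1 A i (suc j) _ = bijection A , bijection-weight A
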